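{- Consider the online capacitated assignment problem: a finite set $S$ of servers is given in advance, each server $s$ with a positive integer capacity $u(s)$; clients arrive one at a time with all their incident edges, and each client may be assigned to a neighboring server, with server $s$ receiving at most $u(s)$ clients. The SAP protocol, upon arrival of a client $c$, augments along a shortest augmenting path from $c$ to a server $s$ currently assigned fewer than $u(s)$ clients (if one exists, ties arbitrary). Then SAP uses at most $O(n\log^2 n)$ reassignments in total, where $n$ is the number of clients.
   Context: An augmenting path from $c$ is a path starting at the unassigned client $c$, alternating between edges not in the current assignment and edges in the current assignment (a server may have several assignment edges), ending at a server with spare capacity; augmenting flips the status of all its edges. -}

module Defs where

open import Data.Nat using (ℕ; zero; suc; _+_; _*_; _∸_; _^_; _≤_; _<_)
open import Data.Nat.Logarithm using (⌊log₂_⌋) public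
open import Data.Fin using (Fin; fromℕ<) renaming (_≟_ to _≟ᶠ_)
open import Data.Maybe using (Maybe; just; nothing)
open import Data.Maybe.Properties using (≡-dec)
open import Data.List using (List; []; _∷_; [_]; length; filter; map; foldr; allFin)
open import Data.List.Relation.Unary.Unique.Propositional using (Unique)
open import Data.Product using (_×_; _,_; proj₁; proj₂; ∃)
open import Data.Bool using (if_then_else_)
open import Relation.Nullary using (¬_; does)
open import Relation.Binary.PropositionalEquality using (_≡_; _≢_)

-- An instance of online capacitated assignment:
--   m servers (Fin m), capacities u, n clients (Fin n), arriving in the
--   order 0, 1, ..., n-1; Edge c s : client c is adjacent to server s.
module Instance (m n : ℕ) (u : Fin m → ℕ) (Edge : Fin n → Fin m → Set) where

  Client = Fin n
  Server = Fin m

  Assignment : Set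
  Assignment = Client → Maybe Server

  empty : Assignment
  empty _ = nothing

  load : Assignment → Server → ℕ
  load σ s = length (filter (λ c → ≡-dec _≟ᶠ_ (σ c) (just s)) (allFin n))

  -- A path  c₀ s₁ c₁ s₂ c₂ ... c_{k-1} s_k  is represented by the list of
  -- non-assignment edges [(c₀,s₁), (c₁,s₂), ..., (c_{k-1},s_k)]; the
  -- assignment edges are (c_i, s_i) for 1 ≤ i < k.
  -- Alternating c ps : ps is such an alternating sequence starting at client c,
  -- ending at a server with spare capacity.
  data Alternating (σ : Assignment) : Client → List (Client × Server) → Set where
    last : ∀ {c s} → Edge c s → σ c ≢ just s → load σ s < u s
         → Alternating σ c [ (c , s) ]
    cons : ∀ {c s c′ ps} → Edge c s → σ c ≢ just s → σ c′ ≡ just s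
         → Alternating σ c′ ps → Alternating σ c ((c , s) ∷ ps)

  record IsAugPath (σ : Assignment) (c : Client) (ps : List (Client × Server)) : Set where
    field
      unassigned : σ c ≡ nothing
      alternating : Alternating σ c ps
      clientsDistinct : Unique (map proj₁ ps)
      serversDistinct : Unique (map proj₂ ps)

  -- shortest augmenting path (length measured by number of edges, which is
  -- 2 * length ps - 1, hence monotone in length ps)
  IsShortestAugPath : Assignment → Client → List (Client × Server) → Set
  IsShortestAugPath σ c ps =
    IsAugPath σ c ps × (∀ qs → IsAugPath σ c qs → length ps ≤ length qs)

  reassign : Client × Server → Assignment → Assignment
  reassign (c , s) σ x = if does (x ≟ᶠ c) then just s else σ x

  augment : Assignment → List (Client × Server) → Assignment
  augment σ ps = foldr reassign σ ps

  -- number of reassignments caused by augmenting along ps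
  -- (every client on the path except the new one changes server)
  reassignments : List (Client × Server) → ℕ
  reassignments ps = length ps ∸ 1

  -- SAPRun t σ r : some execution of SAP (ties broken arbitrarily) after the
  -- arrival of the first t clients ends in assignment σ having performed
  -- r reassignments in total.
  data SAPRun : ℕ → Assignment → ℕ → Set where
    start : SAPRun 0 empty 0
    augmentStep : ∀ {t σ r} → SAPRun t σ r → (lt : t < n)
      → (ps : List (Client × Server)) → IsShortestAugPath σ (fromℕ< lt) ps
      → SAPRun (suc t) (augment σ ps) (r + reassignments ps)
    noPathStep : ∀ {t σ r} → SAPRun t σ r → (lt : t < n)
      → ¬ (∃ λ ps → IsAugPath σ (fromℕ< lt) ps)
      → SAPRun (suc t) σ r

{-# OPTIONS --safe #-}
module Submission where

-- Fix q = p + 1 and let D maximise  q · #{assigned c : N(c) ⊆ T} − p · u(T)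
-- over all sets T of servers.  By Hall's condition the maximum stays between
-- 0 and n, and it rises by q whenever the arriving client has N(c) ⊆ D.
-- Otherwise c sees a server outside D, and maximality of D forces the sets of
-- servers outside D reached by alternating paths to grow by the factor q / p
-- per step as long as they are saturated; as their total capacity is then at
-- most n < 2 ^ L and (q / p) ^ q ≥ 2, spare capacity is met after q · L steps.
-- Hence q times the number of augmentations with more than q · L reassignments
-- is at most n, and summing over q = 2 ^ j for j < L gives n · L + n · L ².
-- This maximum replaces the balanced fractional flow of the usual argument: it
-- is q times the total excess of the server loads of that flow over level p / q.
-- The edge relation may be taken decidable because the bound is ¬¬-stable.

open import Defs
open import Data.Nat using (ℕ; zero; suc; pred; _+_; _*_; _∸_; _^_; _≤_; _<_; z≤n; s≤s; >-nonZero; _≤?_)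
open import Data.Nat.Properties
open import Data.Nat.Logarithm using (⌊log₂⌋-mono-≤; ⌊log₂[2^n]⌋≡n)
open import Data.Nat.Solver using (module +-*-Solver)
open import Data.Fin using (Fin; zero; suc) renaming (_≟_ to _≟ᶠ_)
open import Data.Fin.Properties using (any?; all?; injective⇒≤; sequence) renaming (suc-injective to suc-injectiveᶠ)
open import Data.Fin.Subset using (Subset; ⁅_⁆; _∈_; _∉_; _∪_; ∁; inside; outside) renaming (⊥ to ∅)
open import Data.Fin.Subset.Properties using (_∈?_; x∈⁅x⁆; x∈⁅y⁆⇒x≡y; x∈p∪q⁺; x∈p∪q⁻; x∈∁p⇒x∉p; x∉p⇒x∈∁p; ∉⊥)
open import Data.Vec using ([]; _∷_; tabulate)
open import Data.Vec.Properties using (lookup∘tabulate; []=⇒lookup; lookup⇒[]=)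
open import Data.Maybe using (Maybe; just; nothing)
open import Data.Maybe.Properties using (≡-dec; just-injective)
import Data.List as List
open List using (List; []; _∷_; length; filter; map)
open import Data.List.Properties using (length-map)
open import Data.List.Relation.Unary.Any using (here; there)
open import Data.List.Relation.Unary.All.Properties using (¬Any⇒All¬; All¬⇒¬Any)
open import Data.List.Relation.Unary.AllPairs using ([]; _∷_)
open import Data.List.Relation.Unary.Unique.Propositional using (Unique)
open import Data.List.Membership.Propositional using () renaming (_∈_ to _∈ˡ_; _∉_ to _∉ˡ_)
open import Data.List.Membership.Propositional.Properties using (∈-lookup)
import Data.List.Membership.DecPropositional as DecMembership
open import Data.Product using (_×_; _,_; proj₁; proj₂; ∃)
open import Data.Sum using (_⊎_; inj₁; inj₂)
open import Data.Unit using (tt)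
open import Function using (_∘_; id; case_of_)
open import Level using (0ℓ)
open import Effect.Monad using (RawMonad)
open import Relation.Nullary using (¬_; Dec; yes; no; does; contradiction; ¬?; _×-dec_; _→-dec_)
open import Relation.Nullary.Decidable using (decidable-stable; dec-true; ¬¬-excluded-middle)
open import Relation.Nullary.Negation using (¬¬-Monad; ¬¬-map)
open import Relation.Unary using (Decidable)
open import Relation.Binary.PropositionalEquality using (_≡_; _≢_; refl; sym; trans; cong; cong₂; subst)
open import Algebra.Properties.Semiring.Sum +-*-semiring
open ≤-Reasoning

-- Indicators and finite sums of naturals.

ind : ∀ {P : Set} → Dec P → ℕ
ind (yes _) = 1
ind (no _)  = 0

ind≤1 : ∀ {P : Set} (P? : Dec P) → ind P? ≤ 1
ind≤1 (yes _) = ≤-refl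
ind≤1 (no _)  = z≤n

ind-yes : ∀ {P : Set} (P? : Dec P) → P → ind P? ≡ 1
ind-yes (yes _) p = refl
ind-yes (no ¬p) p = contradiction p ¬p

ind-no : ∀ {P : Set} (P? : Dec P) → ¬ P → ind P? ≡ 0
ind-no (yes p) ¬p = contradiction p ¬p
ind-no (no _)  ¬p = refl

ind-mono : ∀ {P Q : Set} (P? : Dec P) (Q? : Dec Q) → (P → Q) → ind P? ≤ ind Q?
ind-mono (no _)  Q? f = z≤n
ind-mono (yes p) Q? f = ≤-reflexive (sym (ind-yes Q? (f p)))

ind-disjoint : ∀ {P Q R : Set} (P? : Dec P) (Q? : Dec Q) (R? : Dec R) →
  (P → R) → (Q → R) → (P → ¬ Q) → ind P? + ind Q? ≤ ind R?
ind-disjoint (no _)  Q?      R? f g h = ind-mono Q? R? g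
ind-disjoint (yes p) (yes q) R? f g h = contradiction q (h p)
ind-disjoint (yes p) (no _)  R? f g h = ≤-reflexive (sym (ind-yes R? (f p)))

ind-cover : ∀ {P Q R : Set} (P? : Dec P) (Q? : Dec Q) (R? : Dec R) →
  (R → P ⊎ Q) → ind R? ≤ ind P? + ind Q?
ind-cover P? Q? (no _)  f = z≤n
ind-cover P? Q? (yes r) f with f r
... | inj₁ p = ≤-trans (≤-reflexive (sym (ind-yes P? p))) (m≤m+n _ _)
... | inj₂ q = ≤-trans (≤-reflexive (sym (ind-yes Q? q))) (m≤n+m _ _)

sum-mono : ∀ {n} {f g : Fin n → ℕ} → (∀ i → f i ≤ g i) → sum f ≤ sum g
sum-mono {zero}  f≤g = z≤n
sum-mono {suc n} f≤g = +-mono-≤ (f≤g zero) (sum-mono (f≤g ∘ suc))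

sum-const : ∀ n x → sum {n} (λ _ → x) ≡ n * x
sum-const zero    x = refl
sum-const (suc n) x = cong (x +_) (sum-const n x)

term≤sum : ∀ {n} (f : Fin n → ℕ) i → f i ≤ sum f
term≤sum f zero    = m≤m+n _ _
term≤sum f (suc i) = ≤-trans (term≤sum (f ∘ suc) i) (m≤n+m _ _)

-- Cross-addition expresses the change of one summand without truncated subtraction.
sum-update : ∀ {n} (f g : Fin n → ℕ) i → (∀ j → j ≢ i → f j ≡ g j) →
  sum f + g i ≡ sum g + f i
sum-update {suc n} f g zero eq = begin-equality
  f zero + sum (f ∘ suc) + g zero
    ≡⟨ cong (λ x → f zero + x + g zero) (sum-cong-≗ (λ j → eq (suc j) λ ())) ⟩
  f zero + sum (g ∘ suc) + g zero
    ≡⟨ solve 3 (λ a b c → a :+ b :+ c := c :+ b :+ a) refl (f zero) (sum (g ∘ suc)) (g zero) ⟩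
  g zero + sum (g ∘ suc) + f zero ∎
  where open +-*-Solver
sum-update {suc n} f g (suc i) eq = begin-equality
  f zero + sum (f ∘ suc) + g (suc i)   ≡⟨ +-assoc (f zero) _ _ ⟩
  f zero + (sum (f ∘ suc) + g (suc i))
    ≡⟨ cong₂ _+_ (eq zero λ ()) (sum-update (f ∘ suc) (g ∘ suc) i (λ j j≢i → eq (suc j) (j≢i ∘ suc-injectiveᶠ))) ⟩
  g zero + (sum (g ∘ suc) + f (suc i)) ≡⟨ +-assoc (g zero) _ _ ⟨
  g zero + sum (g ∘ suc) + f (suc i)   ∎

sum-single : ∀ {n} (f : Fin n → ℕ) i → (∀ j → j ≢ i → f j ≡ 0) → sum f ≡ f i
sum-single {n} f i eq = begin-equality
  sum f                    ≡⟨ +-identityʳ _ ⟨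
  sum f + 0                ≡⟨ sum-update f (λ _ → 0) i eq ⟩
  sum {n} (λ _ → 0) + f i  ≡⟨ cong (_+ f i) (trans (sum-const n 0) (*-zeroʳ n)) ⟩
  f i                      ∎

-- `load` filters `allFin`, which is `tabulate id`; the induction needs an arbitrary `f`.
length-filter-tabulate : ∀ {A : Set} {P : A → Set} (P? : Decidable P) {n} (f : Fin n → A) →
  length (filter P? (List.tabulate f)) ≡ sum (λ i → ind (P? (f i)))
length-filter-tabulate P? {zero}  f = refl
length-filter-tabulate P? {suc n} f with P? (f zero)
... | yes _ = cong suc (length-filter-tabulate P? (f ∘ suc))
... | no _  = length-filter-tabulate P? (f ∘ suc)

-- Decidable subsets, maximisers and duplicate-free lists.

subset : ∀ {n} {P : Fin n → Set} → Decidable P → Subset n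
subset P? = tabulate (does ∘ P?)

∈-subset⁺ : ∀ {n} {P : Fin n → Set} (P? : Decidable P) {i} → P i → i ∈ subset P?
∈-subset⁺ P? {i} p = lookup⇒[]= i _ (trans (lookup∘tabulate (does ∘ P?) i) (dec-true (P? i) p))

∈-subset⁻ : ∀ {n} {P : Fin n → Set} (P? : Decidable P) {i} → i ∈ subset P? → P i
∈-subset⁻ P? {i} i∈ with P? i | trans (sym (lookup∘tabulate (does ∘ P?) i)) ([]=⇒lookup i∈)
... | yes p | _ = p

maximiser : ∀ {n} (f : Subset n → ℕ) → ∃ λ D → ∀ T → f T ≤ f D
maximiser {zero}  f = [] , λ { [] → ≤-refl }
maximiser {suc n} f with maximiser (f ∘ (inside ∷_)) | maximiser (f ∘ (outside ∷_))
... | D₁ , max₁ | D₂ , max₂ with ≤-total (f (inside ∷ D₁)) (f (outside ∷ D₂))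
... | inj₁ le = outside ∷ D₂ , λ { (inside ∷ T) → ≤-trans (max₁ T) le ; (outside ∷ T) → max₂ T }
... | inj₂ ge = inside ∷ D₁ , λ { (inside ∷ T) → max₁ T ; (outside ∷ T) → ≤-trans (max₂ T) ge }

lookup-injective : ∀ {A : Set} {xs : List A} → Unique xs → ∀ {i j} → List.lookup xs i ≡ List.lookup xs j → i ≡ j
lookup-injective (_ ∷ _)   {zero}  {zero}  eq = refl
lookup-injective (x∉ ∷ _)  {zero}  {suc j} eq = contradiction (subst (_∈ˡ _) (sym eq) (∈-lookup j)) (All¬⇒¬Any x∉)
lookup-injective (x∉ ∷ _)  {suc i} {zero}  eq = contradiction (subst (_∈ˡ _) eq (∈-lookup i)) (All¬⇒¬Any x∉)
lookup-injective (_ ∷ uxs) {suc i} {suc j} eq = cong suc (lookup-injective uxs eq)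

length≤-unique : ∀ {n} {xs : List (Fin n)} → Unique xs → length xs ≤ n
length≤-unique uxs = injective⇒≤ (lookup-injective uxs)

-- Logarithms and exponential growth.

n<2^[1+⌊log₂n⌋] : ∀ n → n < 2 ^ suc ⌊log₂ n ⌋
n<2^[1+⌊log₂n⌋] n = ≰⇒> λ le → 1+n≰n (subst (_≤ ⌊log₂ n ⌋) (⌊log₂[2^n]⌋≡n (suc ⌊log₂ n ⌋)) (⌊log₂⌋-mono-≤ le))

-- This is `(1 + 1/p) ^ k ≥ 1 + k/p` with denominators cleared, which makes sense at `p = 0` too.
bernoulli : ∀ p k → p ^ k * (p + k) ≤ suc p ^ k * p
bernoulli p zero = ≤-reflexive (cong (_+ 0) (+-identityʳ p))
bernoulli p (suc k) = begin
  p * p ^ k * (p + suc k)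
    ≡⟨ solve 3 (λ p k x → p :* x :* (p :+ (con 1 :+ k)) := p :* (x :* (p :+ k)) :+ p :* x) refl p k (p ^ k) ⟩
  p * (p ^ k * (p + k)) + p * p ^ k
    ≤⟨ +-mono-≤ (*-monoʳ-≤ p (bernoulli p k)) (*-monoʳ-≤ p (^-monoˡ-≤ k (n≤1+n p))) ⟩
  p * (suc p ^ k * p) + p * suc p ^ k
    ≡⟨ solve 2 (λ p y → p :* (y :* p) :+ p :* y := (con 1 :+ p) :* y :* p) refl p (suc p ^ k) ⟩
  suc p * suc p ^ k * p ∎
  where open +-*-Solver

-- Bernoulli at `k = p + 1` gives the factor `(2p + 1) / p ≥ 2`. The case `p = 0` is separate
-- because `p` gets cancelled.
2*p^[1+p]≤[1+p]^[1+p] : ∀ p → 2 * p ^ suc p ≤ suc p ^ suc p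
2*p^[1+p]≤[1+p]^[1+p] zero = z≤n
2*p^[1+p]≤[1+p]^[1+p] p@(suc p-1) = *-cancelʳ-≤ _ _ p (begin
  2 * p ^ suc p * p       ≡⟨ solve 2 (λ p x → con 2 :* x :* p := x :* (p :+ p)) refl p (p ^ suc p) ⟩
  p ^ suc p * (p + p)     ≤⟨ *-monoʳ-≤ (p ^ suc p) (+-monoʳ-≤ p (n≤1+n p)) ⟩
  p ^ suc p * (p + suc p) ≤⟨ bernoulli p (suc p) ⟩
  suc p ^ suc p * p       ∎)
  where open +-*-Solver

^-distribʳ-* : ∀ k x y → (x * y) ^ k ≡ x ^ k * y ^ k
^-distribʳ-* zero    x y = refl
^-distribʳ-* (suc k) x y = trans (cong (x * y *_) (^-distribʳ-* k x y))
  (solve 4 (λ a b c d → a :* b :* (c :* d) := a :* c :* (b :* d)) refl x y (x ^ k) (y ^ k))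
  where open +-*-Solver

-- The `k`-th power of the previous inequality makes the growth factor at least `2 ^ k`, hence
-- larger than `n`. The layer argument ends in this contradiction.
growth-bound : ∀ p k {n} → n < 2 ^ k → ¬ (suc p ^ (suc p * k) ≤ p ^ (suc p * k) * n)
growth-bound p k {n} n<2^k le = <⇒≱ n<2^k (*-cancelˡ-≤ P {{>-nonZero P>0}} (begin
  P * 2 ^ k                 ≡⟨ *-comm P (2 ^ k) ⟩
  2 ^ k * P                 ≡⟨ cong (2 ^ k *_) (^-*-assoc p (suc p) k) ⟨
  2 ^ k * (p ^ suc p) ^ k   ≡⟨ ^-distribʳ-* k 2 (p ^ suc p) ⟨
  (2 * p ^ suc p) ^ k       ≤⟨ ^-monoˡ-≤ k (2*p^[1+p]≤[1+p]^[1+p] p) ⟩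
  (suc p ^ suc p) ^ k       ≡⟨ ^-*-assoc (suc p) (suc p) k ⟩
  suc p ^ (suc p * k)       ≤⟨ le ⟩
  P * n                     ∎))
  where
  P = p ^ (suc p * k)
  -- `P` is 0 when `p = 0` and `k > 0`, but then `le` would bound a positive power by 0.
  P>0 : 0 < P
  P>0 = n≢0⇒n>0 λ P≡0 → <⇒≱ (m^n>0 (suc p) (suc p * k)) (≤-trans le (≤-reflexive (cong (_* n) P≡0)))

-- Dyadic decomposition of a path length.

sumBelow : ℕ → (ℕ → ℕ) → ℕ
sumBelow zero    f = 0
sumBelow (suc K) f = f K + sumBelow K f

sumBelow-mono : ∀ K {f g} → (∀ j → f j ≤ g j) → sumBelow K f ≤ sumBelow K g
sumBelow-mono zero    f≤g = z≤n
sumBelow-mono (suc K) f≤g = +-mono-≤ (f≤g K) (sumBelow-mono K f≤g)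

sumBelow-+-const : ∀ K f x → sumBelow K (λ j → f j + x) ≡ sumBelow K f + K * x
sumBelow-+-const zero    f x = refl
sumBelow-+-const (suc K) f x = trans (cong (f K + x +_) (sumBelow-+-const K f x))
  (solve 4 (λ a b c d → a :+ b :+ (c :+ d) := a :+ c :+ (b :+ d)) refl (f K) x (sumBelow K f) (K * x))
  where open +-*-Solver

-- x ≤ c + c * Σ 2 ^ j, summed over the j with 2 ^ j * c < x.
dyadic : ∀ c (A B : ℕ → ℕ) → (∀ j → A j ≤ B j) → ∀ K x → x ≤ 2 ^ K * c →
  (∀ j → 2 ^ j * c < x → 2 ^ j + A j ≤ B j) →
  x + c * sumBelow K A ≤ c + c * sumBelow K B
dyadic c A B A≤B zero x x≤ gain = +-monoˡ-≤ (c * 0) (≤-trans x≤ (≤-reflexive (*-identityˡ c)))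
dyadic c A B A≤B (suc K) x x≤ gain with x ≤? 2 ^ K * c
... | yes small = begin
  x + c * (A K + sumBelow K A)         ≡⟨ solve 4 (λ x c a s → x :+ c :* (a :+ s) := c :* a :+ (x :+ c :* s)) refl x c (A K) (sumBelow K A) ⟩
  c * A K + (x + c * sumBelow K A)     ≤⟨ +-mono-≤ (*-monoʳ-≤ c (A≤B K)) (dyadic c A B A≤B K x small gain) ⟩
  c * B K + (c + c * sumBelow K B)     ≡⟨ solve 3 (λ c a s → c :* a :+ (c :+ c :* s) := c :+ c :* (a :+ s)) refl c (B K) (sumBelow K B) ⟩
  c + c * (B K + sumBelow K B)         ∎
  where open +-*-Solver
-- Scale `K` pays for one half of `2 * 2 ^ K * c`. The other half, `2 ^ K * c`, replaces `x` in the
-- recursion; being below `x`, it inherits `gain`.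
... | no large = begin
  x + c * (A K + sumBelow K A)
    ≤⟨ +-monoˡ-≤ _ x≤ ⟩
  2 * 2 ^ K * c + c * (A K + sumBelow K A)
    ≡⟨ solve 4 (λ y c a s → con 2 :* y :* c :+ c :* (a :+ s) := c :* (y :+ a) :+ (y :* c :+ c :* s)) refl (2 ^ K) c (A K) (sumBelow K A) ⟩
  c * (2 ^ K + A K) + (2 ^ K * c + c * sumBelow K A)
    ≤⟨ +-mono-≤ (*-monoʳ-≤ c (gain K (≰⇒> large)))
         (dyadic c A B A≤B K (2 ^ K * c) ≤-refl (λ j lt → gain j (<-trans lt (≰⇒> large)))) ⟩
  c * B K + (c + c * sumBelow K B)
    ≡⟨ solve 3 (λ c a s → c :* a :+ (c :+ c :* s) := c :+ c :* (a :+ s)) refl c (B K) (sumBelow K B) ⟩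
  c + c * (B K + sumBelow K B) ∎
  where open +-*-Solver

-- Feasible assignments and their preservation by augmentation.

module _ (m n : ℕ) (u : Fin m → ℕ) (Edge : Fin n → Fin m → Set) where
  open Instance m n u Edge

  infix 4 _≟ₘ_
  _≟ₘ_ : (x y : Maybe Server) → Dec (x ≡ y)
  _≟ₘ_ = ≡-dec _≟ᶠ_

  record Feasible (σ : Assignment) : Set where
    field
      assigned-edge : ∀ {c s} → σ c ≡ just s → Edge c s
      load≤u        : ∀ s → load σ s ≤ u s

  open Feasible

  load≡sum : ∀ σ s → load σ s ≡ sum (λ c → ind (σ c ≟ₘ just s))
  load≡sum σ s = length-filter-tabulate (λ c → σ c ≟ₘ just s) id

  reassign-hit : ∀ c s τ → reassign (c , s) τ c ≡ just s
  reassign-hit c s τ rewrite dec-true (c ≟ᶠ c) refl = refl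

  reassign-miss : ∀ {c s x} τ → x ≢ c → reassign (c , s) τ x ≡ τ x
  reassign-miss {c} {s} {x} τ x≢c with x ≟ᶠ c
  ... | yes x≡c = contradiction x≡c x≢c
  ... | no _    = refl

  load-reassign : ∀ c s τ x →
    load (reassign (c , s) τ) x + ind (τ c ≟ₘ just x) ≡ load τ x + ind (just s ≟ₘ just x)
  load-reassign c s τ x = begin-equality
    load (reassign (c , s) τ) x + ind (τ c ≟ₘ just x)
      ≡⟨ cong (_+ ind (τ c ≟ₘ just x)) (load≡sum (reassign (c , s) τ) x) ⟩
    sum (λ i → ind (reassign (c , s) τ i ≟ₘ just x)) + ind (τ c ≟ₘ just x)
      ≡⟨ sum-update _ _ c (λ i i≢c → cong (λ y → ind (y ≟ₘ just x)) (reassign-miss τ i≢c)) ⟩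
    sum (λ i → ind (τ i ≟ₘ just x)) + ind (reassign (c , s) τ c ≟ₘ just x)
      ≡⟨ cong₂ _+_ (sym (load≡sum τ x)) (cong (λ y → ind (y ≟ₘ just x)) (reassign-hit c s τ)) ⟩
    load τ x + ind (just s ≟ₘ just x) ∎

  augment-miss : ∀ σ ps {x} → x ∉ˡ map proj₁ ps → augment σ ps x ≡ σ x
  augment-miss σ []       x∉ = refl
  augment-miss σ (p ∷ ps) x∉ =
    trans (reassign-miss (augment σ ps) (x∉ ∘ here)) (augment-miss σ ps (x∉ ∘ there))

  augment-head : ∀ {σ c ps} → Alternating σ c ps → augment σ ps c ≢ nothing
  augment-head {σ} {c} (last {s = s} _ _ _) eq =
    case trans (sym (reassign-hit c s σ)) eq of λ ()
  augment-head {σ} {c} (cons {s = s} {ps = ps} _ _ _ _) eq =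
    case trans (sym (reassign-hit c s (augment σ ps))) eq of λ ()

  augment-assigned : ∀ σ ps {x} → σ x ≢ nothing → augment σ ps x ≢ nothing
  augment-assigned σ []             σx≢ = σx≢
  augment-assigned σ ((c , s) ∷ ps) {x} σx≢ with x ≟ᶠ c
  ... | yes _ = λ ()
  ... | no _  = augment-assigned σ ps σx≢

  augment-edge : ∀ {σ} → (∀ {c s} → σ c ≡ just s → Edge c s) →
    ∀ {c ps} → Alternating σ c ps → ∀ {x t} → augment σ ps x ≡ just t → Edge x t
  augment-edge ok {c} (last e _ _) {x} eq with x ≟ᶠ c
  augment-edge ok {c} (last e _ _) {x} refl | yes refl = e
  ... | no _     = ok eq
  augment-edge ok {c} (cons e _ _ alt) {x} eq with x ≟ᶠ c
  augment-edge ok {c} (cons e _ _ alt) {x} refl | yes refl = e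
  ... | no _     = augment-edge ok alt eq

  -- The surplus on the left is the slot that the first client of the path vacates.
  augment-load : ∀ {σ} → (∀ s → load σ s ≤ u s) →
    ∀ {c ps} → Alternating σ c ps → Unique (map proj₁ ps) →
    ∀ x → load (augment σ ps) x + ind (σ c ≟ₘ just x) ≤ u x
  augment-load {σ} ok {c} (last {s = s} _ _ spare) _ x
    rewrite load-reassign c s σ x with just s ≟ₘ just x
  ... | yes refl = ≤-trans (≤-reflexive (+-comm _ 1)) spare
  ... | no _     = ≤-trans (≤-reflexive (+-identityʳ _)) (ok x)
  augment-load {σ} ok {c} (cons {s = s} {c′ = c′} {ps = ps} _ _ σc′≡s alt) (c∉ ∷ uniq) x = begin
    load (reassign (c , s) τ) x + ind (σ c ≟ₘ just x)
      ≡⟨ cong (λ y → load (reassign (c , s) τ) x + ind (y ≟ₘ just x)) (augment-miss σ ps (All¬⇒¬Any c∉)) ⟨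
    load (reassign (c , s) τ) x + ind (τ c ≟ₘ just x) ≡⟨ load-reassign c s τ x ⟩
    load τ x + ind (just s ≟ₘ just x) ≡⟨ cong (λ y → load τ x + ind (y ≟ₘ just x)) σc′≡s ⟨
    load τ x + ind (σ c′ ≟ₘ just x)   ≤⟨ augment-load ok alt uniq x ⟩
    u x ∎
    where τ = augment σ ps

  augment-feasible : ∀ {σ c ps} → Feasible σ → IsAugPath σ c ps → Feasible (augment σ ps)
  augment-feasible feas path = record
    { assigned-edge = augment-edge (assigned-edge feas) alternating
    ; load≤u        = λ s → m+n≤o⇒m≤o _ (augment-load (load≤u feas) alternating clientsDistinct s)
    }
    where open IsAugPath path

  empty-feasible : Feasible empty
  empty-feasible = record
    { assigned-edge = λ ()
    ; load≤u        = λ s → ≤-trans (≤-reflexive (trans (load≡sum empty s) (trans (sum-const n 0) (*-zeroʳ n)))) z≤n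
    }

  run-feasible : ∀ {t σ r} → SAPRun t σ r → Feasible σ
  run-feasible start                             = empty-feasible
  run-feasible (augmentStep run _ _ (path , _)) = augment-feasible (run-feasible run) path
  run-feasible (noPathStep run _ _)              = run-feasible run

  -- Removing repetitions from alternating paths.

  module _ (σ : Assignment) where

    Simple : Client → List (Client × Server) → Set
    Simple c ps = Alternating σ c ps × Unique (map proj₁ ps) × Unique (map proj₂ ps)

    -- A possibly empty continuation of an alternating path that has just entered s.
    data Tail (s : Server) : List (Client × Server) → Set where
      halt : load σ s < u s → Tail s []
      via  : ∀ {c ps} → σ c ≡ just s → Simple c ps → Tail s ps

    simple-tail : ∀ {c s ps} → Simple c ((c , s) ∷ ps) → Tail s ps
    simple-tail (last _ _ spare , _)                      = halt spare
    simple-tail (cons _ _ eq alt , (_ ∷ uc) , (_ ∷ us)) = via eq (alt , uc , us)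

    tail-clients-unique : ∀ {s ps} → Tail s ps → Unique (map proj₁ ps)
    tail-clients-unique (halt _)           = []
    tail-clients-unique (via _ (_ , uc , _)) = uc

    tail-servers-unique : ∀ {s ps} → Tail s ps → Unique (map proj₂ ps)
    tail-servers-unique (halt _)           = []
    tail-servers-unique (via _ (_ , _ , us)) = us

    -- Covers the case that the client to be prepended already occurs: the suffix starting at it
    -- serves, and the new edge is dropped.
    from-client : ∀ {s ps} x → Tail s ps → x ∈ˡ map proj₁ ps →
      ∃ λ qs → Simple x qs × length qs ≤ length ps
    from-client x (via _ simple@(last _ _ _ , _)) (here refl) = _ , simple , ≤-refl
    from-client x (via _ simple@(cons _ _ _ _ , _)) (here refl) = _ , simple , ≤-refl
    from-client x (via _ (cons _ _ eq alt , (_ ∷ uc) , (_ ∷ us))) (there x∈)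
      with from-client x (via eq (alt , uc , us)) x∈
    ... | qs , simple , le = qs , simple , m≤n⇒m≤1+n le

    -- Covers the case that the server to be entered already occurs: everything up to its visit is
    -- cut away, so that the new edge can enter `y` directly. Distinctness keeps `y` out of the
    -- rest.
    after-server : ∀ {s ps} x y → Tail s ps → x ∉ˡ map proj₁ ps → y ∈ˡ map proj₂ ps →
      ∃ λ qs → Tail y qs × x ∉ˡ map proj₁ qs × y ∉ˡ map proj₂ qs × length qs ≤ length ps
    after-server x y (via _ simple@(last _ _ _ , _ , (y∉ ∷ _))) x∉ (here refl) =
      _ , simple-tail simple , x∉ ∘ there , All¬⇒¬Any y∉ , n≤1+n _
    after-server x y (via _ simple@(cons _ _ _ _ , _ , (y∉ ∷ _))) x∉ (here refl) =
      _ , simple-tail simple , x∉ ∘ there , All¬⇒¬Any y∉ , n≤1+n _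
    after-server x y (via _ (cons _ _ eq alt , (_ ∷ uc) , (_ ∷ us))) x∉ (there y∈)
      with after-server x y (via eq (alt , uc , us)) (x∉ ∘ there) y∈
    ... | qs , tail , x∉qs , y∉qs , le = qs , tail , x∉qs , y∉qs , m≤n⇒m≤1+n le

    cons-fresh : ∀ {c s ps} → Edge c s → σ c ≢ just s → Tail s ps →
      c ∉ˡ map proj₁ ps → s ∉ˡ map proj₂ ps → Simple c ((c , s) ∷ ps)
    cons-fresh e ne tail c∉ s∉ =
      alternating tail , (¬Any⇒All¬ _ c∉ ∷ tail-clients-unique tail)
                       , (¬Any⇒All¬ _ s∉ ∷ tail-servers-unique tail)
      where
      alternating : ∀ {ps} → Tail _ ps → Alternating σ _ (_ ∷ ps)
      alternating (halt spare)       = last e ne spare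
      alternating (via eq (alt , _)) = cons e ne eq alt

    -- Layers only provide walks, while `IsAugPath` demands distinct clients and servers. Loops are
    -- erased at each prepended edge, so the length is merely bounded, which suffices against a
    -- shortest path.
    extend : ∀ {c s ps} → Edge c s → σ c ≢ just s → Tail s ps →
      ∃ λ qs → Simple c qs × length qs ≤ suc (length ps)
    extend {c} {s} {ps} e ne tail with c ∈ᶜ? map proj₁ ps | s ∈ˢ? map proj₂ ps
      where
      open DecMembership (_≟ᶠ_ {n}) renaming (_∈?_ to _∈ᶜ?_)
      open DecMembership (_≟ᶠ_ {m}) renaming (_∈?_ to _∈ˢ?_)
    ... | yes c∈ | _ with from-client c tail c∈
    ...   | qs , simple , le = qs , simple , m≤n⇒m≤1+n le
    extend {c} {s} {ps} e ne tail | no c∉ | no s∉ = _ , cons-fresh e ne tail c∉ s∉ , ≤-refl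
    extend {c} {s} {ps} e ne tail | no c∉ | yes s∈ with after-server c s tail c∉ s∈
    ...   | qs , tail′ , c∉′ , s∉′ , le = _ , cons-fresh e ne tail′ c∉′ s∉′ , s≤s le

  -- Covered clients, capacities and the potential.

  module _ (Edge? : ∀ c s → Dec (Edge c s)) where

    -- `σ` enters only through its set of assigned clients. Augmenting never shrinks that set, so
    -- reassignments cannot lower the potential.
    Covered : Assignment → Subset m → Client → Set
    Covered σ T c = σ c ≢ nothing × (∀ s → Edge c s → s ∈ T)

    covered? : ∀ σ T c → Dec (Covered σ T c)
    covered? σ T c = ¬? (σ c ≟ₘ nothing) ×-dec all? (λ s → Edge? c s →-dec (s ∈? T))

    coverage : Assignment → Subset m → ℕ
    coverage σ T = sum (λ c → ind (covered? σ T c))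

    weight : Subset m → ℕ
    weight T = sum (λ s → ind (s ∈? T) * u s)

    weight-cover : ∀ {T A B} → (∀ {s} → s ∈ T → s ∈ A ⊎ s ∈ B) → weight T ≤ weight A + weight B
    weight-cover {T} {A} {B} T⊆A∪B = begin
      weight T ≤⟨ sum-mono (λ s → *-monoˡ-≤ (u s) (ind-cover (s ∈? A) (s ∈? B) (s ∈? T) T⊆A∪B)) ⟩
      sum (λ s → (ind (s ∈? A) + ind (s ∈? B)) * u s)
        ≡⟨ sum-cong-≗ (λ s → *-distribʳ-+ (u s) (ind (s ∈? A)) (ind (s ∈? B))) ⟩
      sum (λ s → ind (s ∈? A) * u s + ind (s ∈? B) * u s)
        ≡⟨ ∑-distrib-+ (λ s → ind (s ∈? A) * u s) (λ s → ind (s ∈? B) * u s) ⟩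
      weight A + weight B ∎

    weight+weight-∁≤sum : ∀ T → weight T + weight (∁ T) ≤ sum u
    weight+weight-∁≤sum T = begin
      weight T + weight (∁ T)
        ≡⟨ ∑-distrib-+ (λ s → ind (s ∈? T) * u s) (λ s → ind (s ∈? ∁ T) * u s) ⟨
      sum (λ s → ind (s ∈? T) * u s + ind (s ∈? ∁ T) * u s)
        ≤⟨ sum-mono (λ s → begin
             ind (s ∈? T) * u s + ind (s ∈? ∁ T) * u s   ≡⟨ *-distribʳ-+ (u s) (ind (s ∈? T)) _ ⟨
             (ind (s ∈? T) + ind (s ∈? ∁ T)) * u s
               -- The covering proposition is the trivially true one, whose indicator is 1.
               ≤⟨ *-monoˡ-≤ (u s) (ind-disjoint (s ∈? T) (s ∈? ∁ T) (yes tt) _ _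
                    (λ s∈T s∈∁T → x∈∁p⇒x∉p s∈∁T s∈T)) ⟩
             1 * u s                                     ≡⟨ *-identityˡ (u s) ⟩
             u s                                         ∎) ⟩
      sum u ∎

    Into : Subset m → Maybe Server → Set
    Into T x = ∃ λ s → x ≡ just s × s ∈ T

    into? : ∀ T x → Dec (Into T x)
    into? T x = any? (λ s → (x ≟ₘ just s) ×-dec (s ∈? T))

    sum-into : ∀ T x → sum (λ s → ind (s ∈? T) * ind (x ≟ₘ just s)) ≡ ind (into? T x)
    sum-into T nothing = trans (sum-cong-≗ (λ s → *-zeroʳ (ind (s ∈? T))))
      (trans (trans (sum-const m 0) (*-zeroʳ m)) (sym (ind-no (into? T nothing) λ ())))
    sum-into T (just t) = begin-equality
      sum (λ s → ind (s ∈? T) * ind (just t ≟ₘ just s))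
        ≡⟨ sum-single _ t (λ s s≢t → trans (cong (ind (s ∈? T) *_) (ind-no (just t ≟ₘ just s) (s≢t ∘ sym ∘ just-injective)))
             (*-zeroʳ (ind (s ∈? T)))) ⟩
      ind (t ∈? T) * ind (just t ≟ₘ just t)  ≡⟨ cong (ind (t ∈? T) *_) (ind-yes (just t ≟ₘ just t) refl) ⟩
      ind (t ∈? T) * 1                       ≡⟨ *-identityʳ _ ⟩
      ind (t ∈? T)
        ≡⟨ ≤-antisym (ind-mono (t ∈? T) (into? T (just t)) (λ t∈ → t , refl , t∈))
                     (ind-mono (into? T (just t)) (t ∈? T) (λ { (_ , refl , t∈) → t∈ })) ⟩
      ind (into? T (just t)) ∎

    sum-load : ∀ σ T → sum (λ s → ind (s ∈? T) * load σ s) ≡ sum (λ c → ind (into? T (σ c)))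
    sum-load σ T = begin-equality
      sum (λ s → ind (s ∈? T) * load σ s)
        ≡⟨ sum-cong-≗ (λ s → trans (cong (ind (s ∈? T) *_) (load≡sum σ s))
             (*-distribˡ-sum (ind (s ∈? T)) (λ c → ind (σ c ≟ₘ just s)))) ⟩
      sum (λ s → sum (λ c → ind (s ∈? T) * ind (σ c ≟ₘ just s)))
        ≡⟨ ∑-comm (λ s c → ind (s ∈? T) * ind (σ c ≟ₘ just s)) ⟩
      sum (λ c → sum (λ s → ind (s ∈? T) * ind (σ c ≟ₘ just s)))
        ≡⟨ sum-cong-≗ (λ c → sum-into T (σ c)) ⟩
      sum (λ c → ind (into? T (σ c))) ∎

    -- Saturation turns capacity into a number of clients. This serves both to enlarge the coverage
    -- and to bound the capacity of the last layer by `n`.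
    weight≤into : ∀ σ T → (∀ {s} → s ∈ T → u s ≤ load σ s) →
      weight T ≤ sum (λ c → ind (into? T (σ c)))
    weight≤into σ T full = ≤-trans (sum-mono saturated) (≤-reflexive (sum-load σ T))
      where
      saturated : ∀ s → ind (s ∈? T) * u s ≤ ind (s ∈? T) * load σ s
      saturated s with s ∈? T
      ... | yes s∈ = *-monoʳ-≤ 1 (full s∈)
      ... | no _   = z≤n

    covered⇒into : ∀ {σ T c} → Feasible σ → Covered σ T c → Into T (σ c)
    covered⇒into {σ} {T} {c} feas (assigned , nbrs) with σ c in eq
    ... | nothing = contradiction refl assigned
    ... | just s  = s , refl , nbrs s (assigned-edge feas eq)

    -- The easy half of Hall's condition: a feasible assignment places every covered client inside
    -- `T`.
    coverage≤weight : ∀ {σ} → Feasible σ → ∀ T → coverage σ T ≤ weight T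
    coverage≤weight {σ} feas T = begin
      coverage σ T
        ≤⟨ sum-mono (λ c → ind-mono (covered? σ T c) (into? T (σ c)) (covered⇒into feas)) ⟩
      sum (λ c → ind (into? T (σ c)))     ≡⟨ sum-load σ T ⟨
      sum (λ s → ind (s ∈? T) * load σ s) ≤⟨ sum-mono (λ s → *-monoʳ-≤ (ind (s ∈? T)) (load≤u feas s)) ⟩
      weight T ∎

    count≤n : {P : Client → Set} (P? : Decidable P) → sum (λ c → ind (P? c)) ≤ n
    count≤n P? = ≤-trans (sum-mono (λ c → ind≤1 (P? c))) (≤-reflexive (trans (sum-const n 1) (*-identityʳ n)))

    -- (p + 1) · coverage − p · weight, shifted by the constant p · Σ u to stay in ℕ.
    value : ℕ → Assignment → Subset m → ℕ
    value p σ T = suc p * coverage σ T + p * weight (∁ T)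

    densest : ℕ → Assignment → Subset m
    densest p σ = proj₁ (maximiser (value p σ))

    potential : ℕ → Assignment → ℕ
    potential p σ = value p σ (densest p σ)

    value≤potential : ∀ p σ T → value p σ T ≤ potential p σ
    value≤potential p σ = proj₂ (maximiser (value p σ))

    -- The empty set is the witness, since its complement carries the whole shift.
    potential-empty : ∀ p → p * sum u ≤ potential p empty
    potential-empty p = begin
      p * sum u        ≤⟨ *-monoʳ-≤ p (sum-mono (λ s → ≤-reflexive (sym (trans
                            (cong (_* u s) (ind-yes (s ∈? ∁ ∅) (x∉p⇒x∈∁p ∉⊥))) (*-identityˡ (u s)))))) ⟩
      p * weight (∁ ∅) ≤⟨ m≤n+m _ _ ⟩
      value p empty ∅  ≤⟨ value≤potential p empty ∅ ⟩
      potential p empty ∎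

    -- Write `(p + 1) a - p b = a + p (a - b)` with `a` the coverage and `b` the weight of `D`. Then
    -- `a ≤ n`, and `a ≤ b` by Hall's condition.
    potential-bound : ∀ p {σ} → Feasible σ → potential p σ ≤ p * sum u + n
    potential-bound p {σ} feas = begin
      suc p * coverage σ D + p * weight (∁ D)           ≡⟨ +-assoc (coverage σ D) _ _ ⟩
      coverage σ D + (p * coverage σ D + p * weight (∁ D))
        ≤⟨ +-mono-≤ (count≤n (covered? σ D)) (+-monoˡ-≤ _ (*-monoʳ-≤ p (coverage≤weight feas D))) ⟩
      n + (p * weight D + p * weight (∁ D))             ≡⟨ cong (n +_) (*-distribˡ-+ p (weight D) _) ⟨
      n + p * (weight D + weight (∁ D))                 ≤⟨ +-monoʳ-≤ n (*-monoʳ-≤ p (weight+weight-∁≤sum D)) ⟩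
      n + p * sum u                                     ≡⟨ +-comm n _ ⟩
      p * sum u + n                                     ∎
      where D = densest p σ

    covered-augment : ∀ σ ps {T c} → Covered σ T c → Covered (augment σ ps) T c
    covered-augment σ ps (assigned , nbrs) = augment-assigned σ ps assigned , nbrs

    potential-mono : ∀ p σ ps → potential p σ ≤ potential p (augment σ ps)
    potential-mono p σ ps = ≤-trans
      (+-monoˡ-≤ _ (*-monoʳ-≤ (suc p) (sum-mono λ c →
        ind-mono (covered? σ D c) (covered? (augment σ ps) D c) (covered-augment σ ps))))
      (value≤potential p (augment σ ps) D)
      where D = densest p σ

    -- The old maximiser `D` remains a candidate after augmenting, and the newly assigned `c` raises
    -- its coverage by at least 1.
    potential-gain : ∀ p {σ c ps} → IsAugPath σ c ps → (∀ s → Edge c s → s ∈ densest p σ) →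
      suc p + potential p σ ≤ potential p (augment σ ps)
    potential-gain p {σ} {c} {ps} path nbrs = begin
      suc p + (suc p * coverage σ D + p * weight (∁ D))
        ≡⟨ solve 3 (λ q x y → q :+ (q :* x :+ y) := q :* (x :+ con 1) :+ y) refl (suc p) (coverage σ D) (p * weight (∁ D)) ⟩
      suc p * (coverage σ D + 1) + p * weight (∁ D)
        ≤⟨ +-monoˡ-≤ _ (*-monoʳ-≤ (suc p) more) ⟩
      value p σ′ D
        ≤⟨ value≤potential p σ′ D ⟩
      potential p σ′ ∎
      where
      open +-*-Solver
      open IsAugPath path
      D = densest p σ
      σ′ = augment σ ps
      more : coverage σ D + 1 ≤ coverage σ′ D
      more = begin
        coverage σ D + 1
          ≡⟨ cong (coverage σ D +_) (sym (trans (sum-single (λ x → ind (x ≟ᶠ c)) c (λ x → ind-no (x ≟ᶠ c)))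
               (ind-yes (c ≟ᶠ c) refl))) ⟩
        coverage σ D + sum (λ x → ind (x ≟ᶠ c)) ≡⟨ ∑-distrib-+ (λ x → ind (covered? σ D x)) (λ x → ind (x ≟ᶠ c)) ⟨
        sum (λ x → ind (covered? σ D x) + ind (x ≟ᶠ c))
          ≤⟨ sum-mono (λ x → ind-disjoint (covered? σ D x) (x ≟ᶠ c) (covered? σ′ D x)
               (covered-augment σ ps) (λ { refl → augment-head alternating , nbrs })
               (λ { (assigned , _) refl → assigned unassigned })) ⟩
        coverage σ′ D ∎

    -- Layers of alternating reachability outside `D`, and their expansion.

    module _ (σ : Assignment) (D : Subset m) where

      -- The edge may be the assignment edge of `c`, so a step can stay in place. Otherwise
      -- `step-covered` would fail, as covering a client includes covering its own server.
      Step : Subset m → Server → Set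
      Step T s = s ∉ D × ∃ λ c → Into T (σ c) × Edge c s

      step? : ∀ T s → Dec (Step T s)
      step? T s = ¬? (s ∈? D) ×-dec any? (λ c → into? T (σ c) ×-dec Edge? c s)

      step : Subset m → Subset m
      step T = subset (step? T)

      layer : Server → ℕ → Subset m
      layer s₀ zero    = ⁅ s₀ ⁆
      layer s₀ (suc k) = step (layer s₀ k)

      layer-avoids : ∀ {s₀} → s₀ ∉ D → ∀ k {s} → s ∈ layer s₀ k → s ∉ D
      layer-avoids s₀∉D zero    s∈ with refl ← x∈⁅y⁆⇒x≡y _ s∈ = s₀∉D
      layer-avoids s₀∉D (suc k) s∈ = proj₁ (∈-subset⁻ (step? _) s∈)

      -- Traces the layers backwards with the path built so far as accumulator: one edge for each of
      -- the `k` steps and one from `c` to `s₀`.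
      layer-path : ∀ {c s₀} → σ c ≡ nothing → Edge c s₀ →
        ∀ k {s ps} → s ∈ layer s₀ k → Tail σ s ps →
        ∃ λ qs → IsAugPath σ c qs × length qs ≤ suc k + length ps
      layer-path {c} σc e zero s∈ tail
        with refl ← x∈⁅y⁆⇒x≡y _ s∈
        with extend σ e (λ eq → case trans (sym σc) eq of λ ()) tail
      ... | qs , (alt , uc , us) , le = qs
        , record { unassigned = σc ; alternating = alt ; clientsDistinct = uc ; serversDistinct = us } , le
      layer-path σc e (suc k) {s} {ps} s∈ tail with ∈-subset⁻ (step? _) s∈
      ... | _ , c′ , (t , σc′ , t∈) , e′ with σ c′ ≟ₘ just s
      -- Here `c′` already sits on `s`, so `s` itself lies in the previous layer and no edge is
      -- added.
      ...   | yes eq with refl ← just-injective (trans (sym σc′) eq) with layer-path σc e k t∈ tail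
      ...     | qs , path , le = qs , path , m≤n⇒m≤1+n le
      layer-path σc e (suc k) {s} {ps} s∈ tail | _ , c′ , (t , σc′ , t∈) , e′ | no ne
        with extend σ e′ ne tail
      ...   | rs , simple , le′ with layer-path σc e k t∈ (via σc′ simple)
      ...     | qs , path , le = qs , path , ≤-trans le
                  (≤-trans (+-monoʳ-≤ (suc k) le′) (≤-reflexive (+-suc (suc k) (length ps))))

      step-covered : ∀ {T c} → Into T (σ c) → Covered σ (D ∪ step T) c
      step-covered {T} {c} into@(_ , σc , _) = (λ eq → case trans (sym eq) σc of λ ()) , nbrs
        where
        nbrs : ∀ s → Edge c s → s ∈ D ∪ step T
        nbrs s e with s ∈? D
        ... | yes s∈D = x∈p∪q⁺ (inj₁ s∈D)
        ... | no s∉D  = x∈p∪q⁺ (inj₂ (∈-subset⁺ (step? T) (s∉D , c , into , e)))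

      module _ (feas : Feasible σ) where

        -- Clients covered by `D` are assigned inside `D`, hence differ from those assigned into
        -- `T`. Both kinds are covered by `D ∪ step T`, and saturation makes the latter at least
        -- `weight T` many.
        coverage-step : ∀ T → (∀ {s} → s ∈ T → s ∉ D) → (∀ {s} → s ∈ T → u s ≤ load σ s) →
          coverage σ D + weight T ≤ coverage σ (D ∪ step T)
        coverage-step T avoids full = begin
          coverage σ D + weight T
            ≤⟨ +-monoʳ-≤ (coverage σ D) (weight≤into σ T full) ⟩
          coverage σ D + sum (λ c → ind (into? T (σ c)))
            ≡⟨ ∑-distrib-+ (λ c → ind (covered? σ D c)) (λ c → ind (into? T (σ c))) ⟨
          sum (λ c → ind (covered? σ D c) + ind (into? T (σ c)))
            ≤⟨ sum-mono (λ c → ind-disjoint (covered? σ D c) (into? T (σ c)) (covered? σ (D ∪ step T) c)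
                 (λ (assigned , nbrs) → assigned , λ s e → x∈p∪q⁺ (inj₁ (nbrs s e)))
                 step-covered
                 (λ (_ , nbrs) (s , σc , s∈T) → avoids s∈T (nbrs s (assigned-edge feas σc)))) ⟩
          coverage σ (D ∪ step T) ∎

        -- Passing from `D` to `D ∪ step T` gains at least `weight T` in coverage and costs at most
        -- `weight (step T)` in capacity. Maximality of `D` forbids a net profit.
        weight-step : ∀ p → (∀ T → value p σ T ≤ value p σ D) →
          ∀ T → (∀ {s} → s ∈ T → s ∉ D) → (∀ {s} → s ∈ T → u s ≤ load σ s) →
          suc p * weight T ≤ p * weight (step T)
        weight-step p max T avoids full = +-cancelˡ-≤ (suc p * coverage σ D + p * weight (∁ D⁺)) _ _ (begin
          suc p * coverage σ D + p * weight (∁ D⁺) + suc p * weight T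
            ≡⟨ solve 4 (λ q a y b → q :* a :+ y :+ q :* b := q :* (a :+ b) :+ y) refl
                 (suc p) (coverage σ D) (p * weight (∁ D⁺)) (weight T) ⟩
          suc p * (coverage σ D + weight T) + p * weight (∁ D⁺)
            ≤⟨ +-monoˡ-≤ _ (*-monoʳ-≤ (suc p) (coverage-step T avoids full)) ⟩
          value p σ D⁺
            ≤⟨ max D⁺ ⟩
          suc p * coverage σ D + p * weight (∁ D)
            ≤⟨ +-monoʳ-≤ (suc p * coverage σ D) (*-monoʳ-≤ p (weight-cover {∁ D} {∁ D⁺} {step T} split)) ⟩
          suc p * coverage σ D + p * (weight (∁ D⁺) + weight (step T))
            ≡⟨ solve 4 (λ x p y z → x :+ p :* (y :+ z) := x :+ p :* y :+ p :* z) refl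
                 (suc p * coverage σ D) p (weight (∁ D⁺)) (weight (step T)) ⟩
          suc p * coverage σ D + p * weight (∁ D⁺) + p * weight (step T) ∎)
          where
          open +-*-Solver
          D⁺ = D ∪ step T
          split : ∀ {s} → s ∈ ∁ D → s ∈ ∁ D⁺ ⊎ s ∈ step T
          split {s} s∈∁D with s ∈? step T
          ... | yes s∈ = inj₂ s∈
          ... | no s∉  = inj₁ (x∉p⇒x∈∁p λ s∈D⁺ → case x∈p∪q⁻ D (step T) s∈D⁺ of λ where
                    (inj₁ s∈D) → x∈∁p⇒x∉p s∈∁D s∈D
                    (inj₂ s∈)  → s∉ s∈)

        -- Iterates `weight-step` from a single server of positive capacity, with the factor
        -- `(p + 1) / p` cleared of its denominator.
        layer-growth : ∀ p → (∀ T → value p σ T ≤ value p σ D) → ∀ {s₀} → s₀ ∉ D → 0 < u s₀ →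
          ∀ k → (∀ {j} → j < k → ∀ {s} → s ∈ layer s₀ j → u s ≤ load σ s) →
          suc p ^ k ≤ p ^ k * weight (layer s₀ k)
        layer-growth p max {s₀} s₀∉D u>0 zero full = begin
          1                      ≤⟨ u>0 ⟩
          u s₀                   ≡⟨ *-identityˡ (u s₀) ⟨
          1 * u s₀               ≡⟨ cong (_* u s₀) (ind-yes (s₀ ∈? ⁅ s₀ ⁆) (x∈⁅x⁆ s₀)) ⟨
          ind (s₀ ∈? ⁅ s₀ ⁆) * u s₀ ≤⟨ term≤sum (λ s → ind (s ∈? ⁅ s₀ ⁆) * u s) s₀ ⟩
          weight ⁅ s₀ ⁆          ≡⟨ *-identityˡ (weight ⁅ s₀ ⁆) ⟨
          1 * weight ⁅ s₀ ⁆      ∎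
        layer-growth p max {s₀} s₀∉D u>0 (suc k) full = begin
          suc p * suc p ^ k
            ≤⟨ *-monoʳ-≤ (suc p) (layer-growth p max s₀∉D u>0 k (λ j<k → full (m<n⇒m<1+n j<k))) ⟩
          suc p * (p ^ k * weight (layer s₀ k))
            ≡⟨ solve 3 (λ q x w → q :* (x :* w) := x :* (q :* w)) refl (suc p) (p ^ k) (weight (layer s₀ k)) ⟩
          p ^ k * (suc p * weight (layer s₀ k))
            ≤⟨ *-monoʳ-≤ (p ^ k) (weight-step p max (layer s₀ k) (layer-avoids s₀∉D k) (full ≤-refl)) ⟩
          p ^ k * (p * weight (layer s₀ (suc k)))
            ≡⟨ solve 3 (λ p x w → x :* (p :* w) := p :* x :* w) refl p (p ^ k) (weight (layer s₀ (suc k))) ⟩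
          p * p ^ k * weight (layer s₀ (suc k)) ∎
          where open +-*-Solver

    -- Long shortest paths and amortised counting.

    module _ (u>0 : ∀ s → 0 < u s) {L : ℕ} (n<2^L : n < 2 ^ L) where

      -- From a neighbour outside `D`, all layers up to `H` would be saturated, as spare capacity
      -- there would give a shorter path. Layer `H` would then have capacity above `n` but be filled
      -- by at most `n` clients.
      long⇒neighbours-dense : ∀ p {σ c ps} → Feasible σ → IsShortestAugPath σ c ps →
        suc p * L < reassignments ps → ∀ s → Edge c s → s ∈ densest p σ
      long⇒neighbours-dense p {σ} {c} {ps} feas (path , shortest) long s₀ e =
        decidable-stable (s₀ ∈? D) λ s₀∉D → growth-bound p L n<2^L (begin
          suc p ^ H
            ≤⟨ layer-growth σ D feas p (value≤potential p σ) s₀∉D (u>0 s₀) H (full ∘ <⇒≤) ⟩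
          p ^ H * weight (layer σ D s₀ H)
            ≤⟨ *-monoʳ-≤ (p ^ H) (≤-trans (weight≤into σ (layer σ D s₀ H) (full ≤-refl))
                 (count≤n (λ x → into? (layer σ D s₀ H) (σ x)))) ⟩
          p ^ H * n ∎)
        where
        open IsAugPath path
        H = suc p * L
        D = densest p σ
        -- A spare server in layer `k` yields a list of at most `k + 1` edges, thus at most `k`
        -- reassignments.
        full : ∀ {k} → k ≤ H → ∀ {s} → s ∈ layer σ D s₀ k → u s ≤ load σ s
        full {k} k≤H s∈ = ≮⇒≥ λ spare → case layer-path σ D unassigned e k s∈ (halt spare) of λ
          (qs , path′ , le) → <⇒≱ long (begin
            length ps ∸ 1 ≤⟨ ∸-monoˡ-≤ 1 (≤-trans (shortest qs path′) le) ⟩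
            k + 0         ≡⟨ +-identityʳ k ⟩
            k             ≤⟨ k≤H ⟩
            H             ∎)

      -- Scale `j` has `q = 2 ^ j`, so `p = 2 ^ j - 1`; at `j = 0` this gives the number of assigned
      -- clients.
      potential₂ : Assignment → ℕ → ℕ
      potential₂ σ j = potential (pred (2 ^ j)) σ

      shift : ℕ → ℕ
      shift j = pred (2 ^ j) * sum u

      potential₂-gain : ∀ {σ c ps} → Feasible σ → IsShortestAugPath σ c ps →
        ∀ j → 2 ^ j * L < reassignments ps → 2 ^ j + potential₂ σ j ≤ potential₂ (augment σ ps) j
      potential₂-gain {σ} {c} {ps} feas sap j long =
        subst (λ q → q + potential₂ σ j ≤ potential₂ (augment σ ps) j) 1+p≡2^j
          (potential-gain p (proj₁ sap) (long⇒neighbours-dense p feas sap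
            (subst (λ q → q * L < reassignments ps) (sym 1+p≡2^j) long)))
        where
        p = pred (2 ^ j)
        1+p≡2^j : suc p ≡ 2 ^ j
        1+p≡2^j = suc-pred (2 ^ j) {{m^n≢0 2 j}}

      -- Each arrival grants `L` free reassignments, and each unit of potential at any scale pays
      -- for `L` more. The `shift` terms on the left offset the constants contained in `value`.
      run-amortised : 0 < L → ∀ {t σ r} → SAPRun t σ r →
        r + L * sumBelow L shift ≤ t * L + L * sumBelow L (potential₂ σ)
      run-amortised L>0 start = *-monoʳ-≤ L (sumBelow-mono L (λ j → potential-empty (pred (2 ^ j))))
      run-amortised L>0 (noPathStep {t} run _ _) =
        ≤-trans (run-amortised L>0 run) (+-monoˡ-≤ _ (m≤n+m (t * L) L))
      -- The old potential is added to both sides, so that the induction hypothesis and `dyadic` can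
      -- simply be summed.
      run-amortised L>0 (augmentStep {t} {σ} {r} run _ ps sap) = +-cancelʳ-≤ (L * Φ) _ _ (begin
        r + x + L * S + L * Φ
          ≡⟨ solve 4 (λ r x s φ → r :+ x :+ s :+ φ := r :+ s :+ (x :+ φ)) refl r x (L * S) (L * Φ) ⟩
        r + L * S + (x + L * Φ)
          ≤⟨ +-mono-≤ (run-amortised L>0 run)
               (dyadic L (potential₂ σ) (potential₂ σ′) (λ j → potential-mono (pred (2 ^ j)) σ ps)
                 L x x≤2^L*L (potential₂-gain (run-feasible run) sap)) ⟩
        t * L + L * Φ + (L + L * Φ′)
          ≡⟨ solve 4 (λ a φ l φ′ → a :+ φ :+ (l :+ φ′) := l :+ a :+ φ′ :+ φ) refl (t * L) (L * Φ) L (L * Φ′) ⟩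
        L + t * L + L * Φ′ + L * Φ ∎)
        where
        open +-*-Solver
        open IsAugPath (proj₁ sap)
        x = reassignments ps
        σ′ = augment σ ps
        S = sumBelow L shift
        Φ = sumBelow L (potential₂ σ)
        Φ′ = sumBelow L (potential₂ σ′)
        -- `L` scales suffice because a path has at most `n` distinct clients.
        x≤2^L*L : x ≤ 2 ^ L * L
        x≤2^L*L = begin
          length ps ∸ 1          ≤⟨ m∸n≤m (length ps) 1 ⟩
          length ps              ≡⟨ length-map proj₁ ps ⟨
          length (map proj₁ ps)  ≤⟨ length≤-unique clientsDistinct ⟩
          n                      ≤⟨ <⇒≤ n<2^L ⟩
          2 ^ L                  ≤⟨ m≤m*n (2 ^ L) L {{>-nonZero L>0}} ⟩
          2 ^ L * L              ∎

      -- Net of the shift, each of the `L` potentials is at most `n` at the end, whence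
      -- `n * L + L * (L * n)`.
      run-bound : 0 < L → ∀ {σ r} → SAPRun n σ r → r ≤ 2 * n * L ^ 2
      run-bound L>0 {σ} {r} run = begin
        r                 ≤⟨ +-cancelʳ-≤ (L * S) _ _ total ⟩
        n * L + L * (L * n)     ≤⟨ +-monoˡ-≤ (L * (L * n)) (*-monoʳ-≤ n (m≤m*n L L {{>-nonZero L>0}})) ⟩
        n * (L * L) + L * (L * n)
          ≡⟨ solve 2 (λ n l → n :* (l :* l) :+ l :* (l :* n) := con 2 :* n :* (l :* (l :* con 1))) refl n L ⟩
        2 * n * L ^ 2     ∎
        where
        open +-*-Solver
        S = sumBelow L shift
        total : r + L * S ≤ n * L + L * (L * n) + L * S
        total = begin
          r + L * S                                   ≤⟨ run-amortised L>0 run ⟩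
          n * L + L * sumBelow L (potential₂ σ)
            ≤⟨ +-monoʳ-≤ (n * L) (*-monoʳ-≤ L (sumBelow-mono L λ j →
                 potential-bound (pred (2 ^ j)) (run-feasible run))) ⟩
          n * L + L * sumBelow L (λ j → shift j + n)  ≡⟨ cong (λ y → n * L + L * y) (sumBelow-+-const L shift n) ⟩
          n * L + L * (S + L * n)
            ≡⟨ solve 4 (λ a l s b → a :+ l :* (s :+ b) := a :+ l :* b :+ l :* s) refl (n * L) L S (L * n) ⟩
          n * L + L * (L * n) + L * S                 ∎

-- Double negation commutes with quantification over a finite type, so excluded middle can be
-- collected over all pairs.
¬¬-decidable₂ : ∀ {m n} (R : Fin m → Fin n → Set) → ¬ ¬ (∀ i j → Dec (R i j))
¬¬-decidable₂ R = sequence ¬¬-applicative (λ i → sequence ¬¬-applicative (λ j → ¬¬-excluded-middle))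
  where ¬¬-applicative = RawMonad.rawApplicative (¬¬-Monad {0ℓ})

theorem3 : ∃ λ (C : ℕ) →
    (m n : ℕ) (u : Fin m → ℕ) → (∀ s → 0 < u s) →
    (Edge : Fin n → Fin m → Set) →
    ∀ σ r → Instance.SAPRun m n u Edge n σ r →
    r ≤ C * n * (suc ⌊log₂ n ⌋ ^ 2)
theorem3 = 2 , λ m n u u>0 Edge σ r run → decidable-stable (r ≤? _)
  -- The `suc` makes `L` positive and `n < 2 ^ L` strict, also for `n ≤ 1`.
  (¬¬-map (λ Edge? → run-bound m n u Edge Edge? u>0 {suc ⌊log₂ n ⌋} (n<2^[1+⌊log₂n⌋] n) (s≤s z≤n) run)
    (¬¬-decidable₂ Edge))
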